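{- Let $\mathfrak{A}$ be a Boolean algebra equipped with a unary operator $\Diamond$. Then $\mathfrak{A}$ has property $\mathcal{V}$ if and only if it has property $\mathcal{R}$, where: ($\mathcal{V}$) for every set $X$ of elements of $\mathfrak{A}$, if the join $\bigvee X$ exists in $\mathfrak{A}$, then $\bigvee\{\Diamond x\mid x\in X\}$ exists in $\mathfrak{A}$ and $\Diamond\bigvee X=\bigvee\{\Diamond x\mid x\in X\}$; ($\mathcal{R}$) for all $a,b\in\mathfrak{A}$, if $a\wedge\Diamond b\neq\bot$, then there is $c\in\mathfrak{A}$ with $c\neq\bot$ and $c\leq b$ such that for all $d\in\mathfrak{A}$ with $d\neq\bot$ and $d\leq c$, we have $a\wedge\Diamond d\neq\bot$.
   Context: A unary operator on a Boolean algebra with bottom element $\bot$ is a function $\Diamond$ on its universe satisfying $\Diamond(x\vee y)=\Diamond x\vee\Diamond y$ for all $x,y$ and $\Diamond\bot=\bot$. The Boolean algebra is not assumed to be complete as a lattice. -}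

module Defs where

open import Level using (Level; _⊔_; suc)
open import Algebra.Core using (Op₁)
open import Algebra.Definitions using (Congruent₁)
open import Algebra.Lattice.Bundles using (BooleanAlgebra)
import Algebra.Lattice.Properties.BooleanAlgebra as BooleanAlgebraProperties
open import Data.Product.Base using (∃-syntax; _×_)
open import Relation.Binary.Bundles using (Poset)
open import Relation.Unary using (Pred; _∈_)

module _ {c ℓ : Level} (𝔄 : BooleanAlgebra c ℓ) where

  open BooleanAlgebra 𝔄
  -- The library's lattice order: x ≤ y is x ≈ x ∧ y.
  open Poset (BooleanAlgebraProperties.poset 𝔄) using (_≤_)

  -- Elements are compared with the setoid equality _≈_, so an operator must
  -- respect it in order to be a function on the universe.
  record IsOperator (◇ : Op₁ Carrier) : Set (c ⊔ ℓ) where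
    field
      ◇-cong : Congruent₁ _≈_ ◇
      ◇-∨    : ∀ x y → ◇ (x ∨ y) ≈ ◇ x ∨ ◇ y
      ◇-⊥    : ◇ ⊥ ≈ ⊥

  -- A set of elements is a predicate on the carrier. It need not respect
  -- _≈_: closing it under _≈_ does not change its upper bounds.
  IsUpperBound : ∀ {p} → Pred Carrier p → Carrier → Set (c ⊔ ℓ ⊔ p)
  IsUpperBound X u = ∀ x → x ∈ X → x ≤ u

  IsJoin : ∀ {p} → Pred Carrier p → Carrier → Set (c ⊔ ℓ ⊔ p)
  IsJoin X s = IsUpperBound X s × (∀ u → IsUpperBound X u → s ≤ u)

  Image : ∀ {p} → Op₁ Carrier → Pred Carrier p → Pred Carrier (c ⊔ ℓ ⊔ p)
  Image ◇ X y = ∃[ x ] (x ∈ X × y ≈ ◇ x)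

  -- There is one property for each universe level p of the sets X; under
  -- excluded middle they are all equivalent.
  Property-𝒱 : (p : Level) → Op₁ Carrier → Set (c ⊔ ℓ ⊔ suc p)
  Property-𝒱 p ◇ =
    ∀ (X : Pred Carrier p) s → IsJoin X s →
    ∃[ t ] (IsJoin (Image ◇ X) t × ◇ s ≈ t)

  Property-ℛ : Op₁ Carrier → Set (c ⊔ ℓ)
  Property-ℛ ◇ =
    ∀ a b → a ∧ ◇ b ≉ ⊥ →
    ∃[ e ] (e ≉ ⊥ × e ≤ b × (∀ d → d ≉ ⊥ → d ≤ e → a ∧ ◇ d ≉ ⊥))

{-# OPTIONS --safe #-}
module Submission where

open import Defs
open import Level using (Level; Lift; lift; lower; _⊔_)
open import Algebra.Core using (Op₁)
open import Algebra.Lattice.Bundles using (BooleanAlgebra)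
import Algebra.Lattice.Properties.BooleanAlgebra as BooleanAlgebraProperties
open import Axiom.DoubleNegationElimination using (em⇒dne)
open import Axiom.ExcludedMiddle using (ExcludedMiddle)
open import Data.Product.Base using (_×_; _,_)
open import Function.Bundles using (_⇔_; mk⇔)
open import Relation.Binary.Definitions using (Monotonic₁)
import Relation.Binary.Lattice.Bundles as Order
import Relation.Binary.Reasoning.Setoid as SetoidReasoning
open import Relation.Nullary.Decidable using (map′; True; toWitness; fromWitness)
open import Relation.Unary using (Pred; _∈_)

-- Both directions are by contradiction, using x ≤ y ⇔ ¬ y ∧ x ≈ ⊥.
--
-- 𝒱 ⇒ ℛ: if a and b violate ℛ, then every nonzero e ≤ b has a nonzero d ≤ e
-- with a ∧ ◇ d ≈ ⊥, so b is the join of X = { d ≤ b | a ∧ ◇ d ≈ ⊥ }.  By 𝒱,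
-- ◇ b is the join of ◇ X, which is bounded by ¬ a; hence a ∧ ◇ b ≈ ⊥.
--
-- ℛ ⇒ 𝒱: let s be the join of X and u an upper bound of ◇ X.  If ◇ s ≰ u, then
-- ℛ for ¬ u and s yields a nonzero e ≤ s.  For x ∈ X the element e ∧ x lies
-- below e, and ◇ (e ∧ x) ≤ ◇ x ≤ u forces e ∧ x ≈ ⊥.  Hence ¬ e is an upper
-- bound of X, so e ≤ s ≤ ¬ e, and e ≈ ⊥.

-- A type is decided by deciding its lift to the larger universe. This lets a single hypothesis, at
-- the join of all levels, serve each smaller one.
em-lower : ∀ {a} b → ExcludedMiddle (a ⊔ b) → ExcludedMiddle a
em-lower b em {P} = map′ lower lift (em {Lift b P})

module _ {c ℓ : Level} (𝔄 : BooleanAlgebra c ℓ) where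

  open BooleanAlgebra 𝔄
  open BooleanAlgebraProperties 𝔄
    using ( ∧-identityʳ; ∧-zeroˡ; ∨-identityˡ; ¬-involutive
          ; ∨-∧-orderTheoreticLattice )
  open Order.Lattice ∨-∧-orderTheoreticLattice
    using (_≤_; x≤x∨y; x∧y≤x; x∧y≤y; ≤-respʳ-≈; ≤-respˡ-≈)
    renaming (refl to ≤-refl; trans to ≤-trans)
  open SetoidReasoning setoid

  ≤¬⇒∧≈⊥ : ∀ {x y} → x ≤ ¬ y → y ∧ x ≈ ⊥
  ≤¬⇒∧≈⊥ {x} {y} x≤¬y = begin
    -- The order is an equation: `x≤¬y` is `x ≈ x ∧ ¬ y` and rewrites `x` directly.
    y ∧ x          ≈⟨ ∧-congˡ x≤¬y ⟩
    y ∧ (x ∧ ¬ y)  ≈⟨ ∧-congˡ (∧-comm x (¬ y)) ⟩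
    y ∧ (¬ y ∧ x)  ≈⟨ ∧-assoc y (¬ y) x ⟨
    (y ∧ ¬ y) ∧ x  ≈⟨ ∧-congʳ (∧-complementʳ y) ⟩
    ⊥ ∧ x          ≈⟨ ∧-zeroˡ x ⟩
    ⊥              ∎

  ∧≈⊥⇒≤¬ : ∀ {x y} → y ∧ x ≈ ⊥ → x ≤ ¬ y
  ∧≈⊥⇒≤¬ {x} {y} y∧x≈⊥ = begin
    x                    ≈⟨ ∧-identityʳ x ⟨
    x ∧ ⊤                ≈⟨ ∧-congˡ (∨-complementʳ y) ⟨
    x ∧ (y ∨ ¬ y)        ≈⟨ ∧-distribˡ-∨ x y (¬ y) ⟩
    (x ∧ y) ∨ (x ∧ ¬ y)  ≈⟨ ∨-congʳ (trans (∧-comm x y) y∧x≈⊥) ⟩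
    ⊥ ∨ (x ∧ ¬ y)        ≈⟨ ∨-identityˡ (x ∧ ¬ y) ⟩
    x ∧ ¬ y              ∎

  ≤⇒¬∧≈⊥ : ∀ {x y} → x ≤ y → ¬ y ∧ x ≈ ⊥
  ≤⇒¬∧≈⊥ {y = y} x≤y = ≤¬⇒∧≈⊥ (≤-respʳ-≈ (sym (¬-involutive y)) x≤y)

  ¬∧≈⊥⇒≤ : ∀ {x y} → ¬ y ∧ x ≈ ⊥ → x ≤ y
  ¬∧≈⊥⇒≤ {y = y} ¬y∧x≈⊥ = ≤-respʳ-≈ (¬-involutive y) (∧≈⊥⇒≤¬ ¬y∧x≈⊥)

  ≤∧≤¬⇒≈⊥ : ∀ {x y} → x ≤ y → x ≤ ¬ y → x ≈ ⊥
  ≤∧≤¬⇒≈⊥ {x} {y} x≤y x≤¬y =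
    trans x≤y (trans (∧-comm x y) (≤¬⇒∧≈⊥ x≤¬y))

  module _ {◇ : Op₁ Carrier} (isOperator : IsOperator 𝔄 ◇) where

    open IsOperator isOperator

    -- Additivity gives this: if `x ≤ y` then `x ∨ y` is `y`, so `◇ y` is `◇ x ∨ ◇ y`.
    ◇-mono : Monotonic₁ _≤_ _≤_ ◇
    ◇-mono {x} {y} x≤y = ≤-respʳ-≈ ◇x∨◇y≈◇y (x≤x∨y (◇ x) (◇ y))
      where
      ◇x∨◇y≈◇y : ◇ x ∨ ◇ y ≈ ◇ y
      ◇x∨◇y≈◇y = begin
        ◇ x ∨ ◇ y      ≈⟨ ◇-∨ x y ⟨
        ◇ (x ∨ y)      ≈⟨ ◇-cong (∨-congʳ (trans x≤y (∧-comm x y))) ⟩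
        ◇ (y ∧ x ∨ y)  ≈⟨ ◇-cong (∨-comm (y ∧ x) y) ⟩
        ◇ (y ∨ y ∧ x)  ≈⟨ ◇-cong (∨-absorbs-∧ y x) ⟩
        ◇ y            ∎

    𝒱⇒ℛ : ∀ {p} → ExcludedMiddle (c ⊔ ℓ) → Property-𝒱 𝔄 p ◇ → Property-ℛ 𝔄 ◇
    𝒱⇒ℛ {p} em 𝒱 a b a∧◇b≉⊥ = em⇒dne em λ ¬ℛ →
      let
        b-least : ∀ u → IsUpperBound 𝔄 X u → b ≤ u
        b-least u u-bound = ¬∧≈⊥⇒≤ (em⇒dne dec λ ¬u∧b≉⊥ → ¬ℛ
          -- The part of `b` outside `u`, if nonzero, would witness ℛ: a nonzero `d` below it with
          -- `a ∧ ◇ d ≈ ⊥` lies in `X`, hence under both `u` and `¬ u`.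
          ( ¬ u ∧ b , ¬u∧b≉⊥ , x∧y≤y (¬ u) b , λ d d≉⊥ d≤¬u∧b a∧◇d≈⊥ →
            d≉⊥ (≤∧≤¬⇒≈⊥
              (u-bound d (X-intro (≤-trans d≤¬u∧b (x∧y≤y (¬ u) b)) a∧◇d≈⊥))
              (≤-trans d≤¬u∧b (x∧y≤x (¬ u) b)))))
        t , (_ , t-least) , ◇b≈t = 𝒱 X b (X-bound , b-least)
      in a∧◇b≉⊥ (≤¬⇒∧≈⊥ (≤-respˡ-≈ (sym ◇b≈t) (t-least (¬ a) ¬a-bound)))
      where
      dec : ExcludedMiddle ℓ
      dec = em-lower c em

      -- Excluded middle replaces the defining condition by a decision, which
      -- lives in the lowest universe and so can be lifted to any level p.
      X : Pred Carrier p
      X d = Lift p (True (dec {d ≤ b × a ∧ ◇ d ≈ ⊥}))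

      X-intro : ∀ {d} → d ≤ b → a ∧ ◇ d ≈ ⊥ → d ∈ X
      X-intro d≤b a∧◇d≈⊥ = lift (fromWitness (d≤b , a∧◇d≈⊥))

      X-elim : ∀ {d} → d ∈ X → d ≤ b × a ∧ ◇ d ≈ ⊥
      X-elim (lift d∈X) = toWitness d∈X

      X-bound : IsUpperBound 𝔄 X b
      X-bound d d∈X = let d≤b , _ = X-elim d∈X in d≤b

      ¬a-bound : IsUpperBound 𝔄 (Image 𝔄 ◇ X) (¬ a)
      ¬a-bound y (d , d∈X , y≈◇d) =
        let _ , a∧◇d≈⊥ = X-elim d∈X in ≤-respˡ-≈ (sym y≈◇d) (∧≈⊥⇒≤¬ a∧◇d≈⊥)

    -- Double negation is eliminated only from equations here, hence excluded middle at level `ℓ`;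
    -- the converse eliminates it from an existential over the carrier.
    ℛ⇒𝒱 : ∀ {p} → ExcludedMiddle ℓ → Property-ℛ 𝔄 ◇ → Property-𝒱 𝔄 p ◇
    ℛ⇒𝒱 em ℛ X s (s-bound , s-least) = ◇ s , (◇s-bound , ◇s-least) , refl
      where
      ◇s-bound : IsUpperBound 𝔄 (Image 𝔄 ◇ X) (◇ s)
      ◇s-bound y (x , x∈X , y≈◇x) =
        ≤-respˡ-≈ (sym y≈◇x) (◇-mono (s-bound x x∈X))

      ◇s-least : ∀ u → IsUpperBound 𝔄 (Image 𝔄 ◇ X) u → ◇ s ≤ u
      ◇s-least u u-bound = ¬∧≈⊥⇒≤ (em⇒dne em λ ¬u∧◇s≉⊥ →
        let
          e , e≉⊥ , e≤s , e-dense = ℛ (¬ u) s ¬u∧◇s≉⊥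
          ¬e-bound : IsUpperBound 𝔄 X (¬ e)
          ¬e-bound x x∈X = ∧≈⊥⇒≤¬ (em⇒dne em λ e∧x≉⊥ →
            e-dense (e ∧ x) e∧x≉⊥ (x∧y≤x e x)
              (≤⇒¬∧≈⊥ (≤-trans (◇-mono (x∧y≤y e x))
                                (u-bound (◇ x) (x , x∈X , refl)))))
        in e≉⊥ (≤∧≤¬⇒≈⊥ ≤-refl (≤-trans e≤s (s-least (¬ e) ¬e-bound))))

corollary4p5 : ∀ {c ℓ p} → ExcludedMiddle (c ⊔ ℓ ⊔ p) →
    (𝔄 : BooleanAlgebra c ℓ) (◇ : Op₁ (BooleanAlgebra.Carrier 𝔄)) →
    IsOperator 𝔄 ◇ →
    Property-𝒱 𝔄 p ◇ ⇔ Property-ℛ 𝔄 ◇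
corollary4p5 {c} {ℓ} {p} em 𝔄 ◇ isOperator = mk⇔
  (𝒱⇒ℛ 𝔄 isOperator (em-lower p em))
  (ℛ⇒𝒱 𝔄 isOperator (em-lower (c ⊔ p) em))
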